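{- Let $n\ge 2$ and let $\mathcal{G}\subseteq 2^{[n]}$ be an IU-family, i.e. $G\cap G'\neq\emptyset$ and $G\cup G'\neq[n]$ for all $G,G'\in\mathcal{G}$. Then $\beta(\mathcal{G})\le 2^{n-4}$.
   Context: $[n]=\{1,\dots,n\}$ and $2^{[n]}$ is the family of all subsets of $[n]$. For $\mathcal{F}\subseteq 2^{[n]}$ and distinct $i,j\in[n]$, let $\mathcal{F}(i,\bar{j})=\{F\setminus\{i\}: F\in\mathcal{F},\ F\cap\{i,j\}=\{i\}\}$. The sturdiness of $\mathcal{F}$ is $\beta(\mathcal{F})=\min_{1\le i\neq j\le n}|\mathcal{F}(i,\bar{j})|$. -}

module Defs where

open import Data.Bool.Base using (Bool; T)
open import Data.Bool.Properties using (T?) renaming (_≟_ to _≟ᵇ_)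
open import Data.Fin.Base using (Fin; zero; suc)
open import Data.Fin.Properties using (_≟_)
open import Data.Fin.Subset
  using (Subset; inside; outside; ⊤; ⊥; ⁅_⁆; _∩_; _∪_; _-_)
open import Data.Fin.Subset.Properties using (anySubset?)
open import Data.List.Base
  using (List; []; _∷_; _++_; allFin; cartesianProduct; filter; filterᵇ; length; map)
open import Data.List.Extrema.Nat using (min)
open import Data.Nat.Base using (ℕ; zero; suc; _≤_; z≤n; s≤s)
open import Data.Product.Base using (∃-syntax; _×_; _,_; uncurry)
open import Data.Vec.Base using ([]; _∷_)
open import Data.Vec.Properties using (≡-dec)
open import Relation.Binary.Definitions using (DecidableEquality)
open import Relation.Binary.PropositionalEquality using (_≡_; _≢_)
open import Relation.Nullary.Decidable using (Dec; does; ¬?; _×-dec_)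

private
  variable
    n : ℕ

-- A family 𝓕 ⊆ 2^[n] is given by its characteristic function; [n] is Fin n.
Family : ℕ → Set
Family n = Subset n → Bool

infix 4 _∈ᶠ_
_∈ᶠ_ : Subset n → Family n → Set
A ∈ᶠ 𝓕 = T (𝓕 A)

-- Every subset of Fin n, listed exactly once.
subsets : ∀ n → List (Subset n)
subsets zero    = [] ∷ []
subsets (suc n) = map (outside ∷_) (subsets n) ++ map (inside ∷_) (subsets n)

size : Family n → ℕ
size {n} 𝓕 = length (filterᵇ 𝓕 (subsets n))

_≟ˢ_ : DecidableEquality (Subset n)
_≟ˢ_ = ≡-dec _≟ᵇ_

-- A ∈ 𝓕(i, j̄), where 𝓕(i, j̄) = { F ∖ {i} : F ∈ 𝓕, F ∩ {i, j} = {i} }.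
InSection : Family n → Fin n → Fin n → Subset n → Set
InSection 𝓕 i j A = ∃[ F ] F ∈ᶠ 𝓕 × F ∩ (⁅ i ⁆ ∪ ⁅ j ⁆) ≡ ⁅ i ⁆ × A ≡ F - i

inSection? : (𝓕 : Family n) (i j : Fin n) (A : Subset n) → Dec (InSection 𝓕 i j A)
inSection? 𝓕 i j A = anySubset? λ F →
  T? (𝓕 F) ×-dec (F ∩ (⁅ i ⁆ ∪ ⁅ j ⁆)) ≟ˢ ⁅ i ⁆ ×-dec A ≟ˢ (F - i)

section : Family n → Fin n → Fin n → Family n
section 𝓕 i j A = does (inSection? 𝓕 i j A)

distinctPairs : ∀ n → List (Fin n × Fin n)
distinctPairs n =
  filter (uncurry λ i j → ¬? (i ≟ j)) (cartesianProduct (allFin n) (allFin n))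

-- For n ≥ 2 the minimum is over a nonempty set.  The default value that `min`
-- takes is the entry at the distinct pair (0, 1), so it does not affect the result.
sturdiness : 2 ≤ n → Family n → ℕ
sturdiness {n} (s≤s (s≤s z≤n)) 𝓕 =
  min (size (section 𝓕 zero (suc zero)))
      (map (uncurry λ i j → size (section 𝓕 i j)) (distinctPairs n))

-- G and G′ need not be distinct.
IsIU : Family n → Set
IsIU 𝓖 = ∀ G G′ → G ∈ᶠ 𝓖 → G′ ∈ᶠ 𝓖 → G ∩ G′ ≢ ⊥ × G ∪ G′ ≢ ⊤

{-# OPTIONS --safe #-}

-- Only the pair of indices 0, 1 matters.  On the other k = n − 2 points let P and Q be
-- the traces of the members G with G ∩ {0, 1} = {0} and G ∩ {0, 1} = {1}.  Since P and Q
-- are cross-intersecting, no set lies in the up-closure ↑P while its complement lies in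
-- ↑Q, so |↑P| + |↑Q| ≤ 2^k; dually |↓P| + |↓Q| ≤ 2^k.  As P ⊆ ↑P ∩ ↓P, the
-- Harris–Kleitman inequality gives 2^k |P| ≤ |↑P| |↓P|, and likewise for Q.  Multiplying
-- the two and applying AM-GM to |↑P| |↑Q| and |↓P| |↓Q| yields 16 |P| |Q| ≤ 4^k, so
-- min(|P|, |Q|) ≤ 2^(k−2).
module Submission where

open import Data.Nat.Base using (ℕ; _≤_; _*_; _^_)
open import Defs

open import Data.Bool.Base using (Bool; true; false; T; _∧_)
open import Data.Bool.Properties using (T?; T-∧)
open import Data.Empty using (⊥-elim)
open import Data.Fin.Base using (Fin; zero; suc)
open import Data.Fin.Properties using () renaming (_≟_ to _≟ᶠ_)
open import Data.Fin.Subset using (Subset; inside; outside; ⊤; ⊥; _∩_; _∪_; _⊆_; ∁)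
open import Data.Fin.Subset.Properties
open import Data.List.Base as List using (List; filterᵇ; length; map)
open import Data.List.Extrema.Nat using (min≤xs)
open import Data.List.Membership.Propositional.Properties
  using (∈-map⁺; ∈-filter⁺; ∈-cartesianProduct⁺; ∈-allFin)
open import Data.List.Properties using (filter-++; length-++)
import Data.List.Relation.Unary.All as All
open import Data.Nat.Base using (zero; suc; _+_; _∸_; _<_; z≤n; s≤s)
open import Data.Nat.Properties
open import Data.Nat.Tactic.RingSolver using (solve-∀)
open import Data.Product.Base using (∃-syntax; _×_; _,_; proj₁; proj₂; uncurry)
open import Data.Sum.Base using (inj₁; inj₂)
open import Data.Vec.Base using ([]; _∷_)
open import Function.Base using (_∘_)
open import Function.Bundles using (Equivalence)
open import Relation.Binary.PropositionalEquality
  using (_≡_; _≢_; refl; trans; cong; cong₂; subst)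
open import Relation.Nullary.Decidable using (Dec; yes; no; does; ¬?; _×-dec_)
open import Relation.Nullary.Negation using (¬_)

private
  variable
    n : ℕ

-- Decisions and sizes of families.

does⁺ : {P : Set} (P? : Dec P) → P → T (does P?)
does⁺ (yes _) _ = _
does⁺ (no ¬p) p = ⊥-elim (¬p p)

does⁻ : {P : Set} (P? : Dec P) → T (does P?) → P
does⁻ (yes p) _ = p

length-filterᵇ-map : {A B : Set} (f : B → Bool) (h : A → B) (xs : List A) →
                     length (filterᵇ f (map h xs)) ≡ length (filterᵇ (f ∘ h) xs)
length-filterᵇ-map f h List.[]         = refl
length-filterᵇ-map f h (x List.∷ xs) with f (h x)
... | true  = cong suc (length-filterᵇ-map f h xs)
... | false = length-filterᵇ-map f h xs

size-suc : (f : Family (suc n)) →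
           size f ≡ size (f ∘ (outside ∷_)) + size (f ∘ (inside ∷_))
size-suc {n} f
  rewrite filter-++ (T? ∘ f) (map (outside ∷_) (subsets n)) (map (inside ∷_) (subsets n))
        | length-++ (filterᵇ f (map (outside ∷_) (subsets n)))
                    {filterᵇ f (map (inside ∷_) (subsets n))}
        = cong₂ _+_ (length-filterᵇ-map f (outside ∷_) (subsets n))
                    (length-filterᵇ-map f (inside ∷_) (subsets n))

size-mono : (f g : Family n) → (∀ A → A ∈ᶠ f → A ∈ᶠ g) → size f ≤ size g
size-mono {zero} f g f⊆g with f [] | g [] | f⊆g []
... | false | _     | _ = z≤n
... | true  | true  | _ = ≤-refl
... | true  | false | h = ⊥-elim (h _)
size-mono {suc n} f g f⊆g rewrite size-suc f | size-suc g =
  +-mono-≤ (size-mono _ _ (f⊆g ∘ (outside ∷_))) (size-mono _ _ (f⊆g ∘ (inside ∷_)))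

size-empty : (f : Family n) → (∀ A → ¬ A ∈ᶠ f) → size f ≡ 0
size-empty {zero} f f-empty with f [] | f-empty []
... | false | _ = refl
... | true  | h = ⊥-elim (h _)
size-empty {suc n} f f-empty rewrite size-suc f =
  cong₂ _+_ (size-empty _ (f-empty ∘ (outside ∷_))) (size-empty _ (f-empty ∘ (inside ∷_)))

size-outside : (f : Family (suc n)) → (∀ A → ¬ inside ∷ A ∈ᶠ f) →
               size f ≡ size (f ∘ (outside ∷_))
size-outside f f-out =
  trans (size-suc f) (trans (cong (size (f ∘ (outside ∷_)) +_) (size-empty _ f-out)) (+-identityʳ _))

-- Complementation is a bijection carrying `f` outside `g`. In the induction `∁` flips the first
-- entry, so the outside half of `f` is paired with the inside half of `g`, and vice versa.
size-complement : (f g : Family n) → (∀ A → A ∈ᶠ f → ¬ ∁ A ∈ᶠ g) → size f + size g ≤ 2 ^ n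
size-complement {zero} f g disj with f [] | g [] | disj []
... | false | false | _ = z≤n
... | false | true  | _ = ≤-refl
... | true  | false | _ = ≤-refl
... | true  | true  | h = ⊥-elim (h _ _)
size-complement {suc n} f g disj rewrite size-suc f | size-suc g = begin
  (f₀ + f₁) + (g₀ + g₁)  ≡⟨ regroup f₀ f₁ g₀ g₁ ⟩
  (f₀ + g₁) + (f₁ + g₀)  ≤⟨ +-mono-≤ (size-complement _ _ (disj ∘ (outside ∷_)))
                                     (size-complement _ _ (disj ∘ (inside ∷_))) ⟩
  2 ^ n + 2 ^ n          ≡⟨ cong (2 ^ n +_) (+-identityʳ (2 ^ n)) ⟨
  2 ^ suc n              ∎
  where
  open ≤-Reasoning
  f₀ = size (f ∘ (outside ∷_))
  f₁ = size (f ∘ (inside ∷_))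
  g₀ = size (g ∘ (outside ∷_))
  g₁ = size (g ∘ (inside ∷_))
  regroup : ∀ a b c d → (a + b) + (c + d) ≡ (a + d) + (b + c)
  regroup = solve-∀

-- Elementary inequalities.

-- The two sides differ by `(b - a) * (c - d)`; substituting `b = a + x` and `c = d + y` turns this
-- into an identity without subtraction.
rearrangement : ∀ {a b c d} → a ≤ b → d ≤ c → a * c + b * d ≤ a * d + b * c
rearrangement {a} {b} {c} {d} a≤b d≤c =
  subst (λ b → a * c + b * d ≤ a * d + b * c) (m+[n∸m]≡n a≤b)
    (subst (λ c → a * c + (a + x) * d ≤ a * d + (a + x) * c) (m+[n∸m]≡n d≤c)
      (subst (a * (d + y) + (a + x) * d ≤_) (expand a x d y) (m≤m+n _ (x * y))))
  where
  x = b ∸ a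
  y = c ∸ d
  expand : ∀ a x d y →
           (a * (d + y) + (a + x) * d) + x * y ≡ a * d + (a + x) * (d + y)
  expand = solve-∀

4ab≤[a+b]² : ∀ a b → 4 * (a * b) ≤ (a + b) * (a + b)
4ab≤[a+b]² a b = begin
  4 * (a * b)                                ≡⟨ split a b ⟩
  2 * (a * b) + (a * b + b * a)              ≤⟨ +-monoʳ-≤ (2 * (a * b)) crossed ⟩
  2 * (a * b) + (a * a + b * b)              ≡⟨ collect a b ⟩
  (a + b) * (a + b)                          ∎
  where
  open ≤-Reasoning
  split : ∀ a b → 4 * (a * b) ≡ 2 * (a * b) + (a * b + b * a)
  split = solve-∀
  collect : ∀ a b → 2 * (a * b) + (a * a + b * b) ≡ (a + b) * (a + b)
  collect = solve-∀
  crossed : a * b + b * a ≤ a * a + b * b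
  crossed with ≤-total a b
  ... | inj₁ a≤b = rearrangement a≤b a≤b
  ... | inj₂ b≤a = begin
    a * b + b * a  ≡⟨ +-comm (a * b) (b * a) ⟩
    b * a + a * b  ≤⟨ rearrangement b≤a b≤a ⟩
    b * b + a * a  ≡⟨ +-comm (b * b) (a * a) ⟩
    a * a + b * b  ∎

m²≤n²⇒m≤n : ∀ {m n} → m * m ≤ n * n → m ≤ n
m²≤n²⇒m≤n m²≤n² = ≮⇒≥ λ n<m → <⇒≱ (*-mono-< n<m n<m) m²≤n²

-- Multiplying the two product bounds and regrouping `u` with `u′` and `d` with `d′` lets AM-GM
-- apply to each pair. The result compares the squares of `N * (4 * s)` and `N * N`; a square root
-- and a cancellation of `N` finish.
quarter-bound : ∀ {s N u d u′ d′} → 0 < N → N * s ≤ u * d → N * s ≤ u′ * d′ →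
       u + u′ ≤ N → d + d′ ≤ N → 4 * s ≤ N
quarter-bound {s} {N@(suc _)} {u} {d} {u′} {d′} _ Ns≤ud Ns≤u′d′ u+u′≤N d+d′≤N =
  *-cancelˡ-≤ N (m²≤n²⇒m≤n (begin
    (N * (4 * s)) * (N * (4 * s))            ≡⟨ pull N s ⟩
    16 * ((N * s) * (N * s))                 ≤⟨ *-monoʳ-≤ 16 (*-mono-≤ Ns≤ud Ns≤u′d′) ⟩
    16 * ((u * d) * (u′ * d′))               ≡⟨ swap u d u′ d′ ⟩
    (4 * (u * u′)) * (4 * (d * d′))          ≤⟨ *-mono-≤ (4ab≤[a+b]² u u′) (4ab≤[a+b]² d d′) ⟩
    ((u + u′) * (u + u′)) * ((d + d′) * (d + d′))
      ≤⟨ *-mono-≤ (*-mono-≤ u+u′≤N u+u′≤N) (*-mono-≤ d+d′≤N d+d′≤N) ⟩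
    (N * N) * (N * N)                        ∎))
  where
  open ≤-Reasoning
  pull : ∀ N s → (N * (4 * s)) * (N * (4 * s)) ≡ 16 * ((N * s) * (N * s))
  pull = solve-∀
  swap : ∀ u d u′ d′ → 16 * ((u * d) * (u′ * d′)) ≡ (4 * (u * u′)) * (4 * (d * d′))
  swap = solve-∀

-- The Harris-Kleitman inequality and closures.

IsUpper IsLower : Family n → Set
IsUpper f = ∀ {A B} → A ⊆ B → A ∈ᶠ f → B ∈ᶠ f
IsLower f = ∀ {A B} → A ⊆ B → B ∈ᶠ f → A ∈ᶠ f

-- Induction on the first coordinate. Monotonicity gives `u₀ ≤ u₁` and `d₁ ≤ d₀`, so the parallel
-- sum `u₀ * d₀ + u₁ * d₁` from the induction hypothesis is at most the crossed one, and together
-- they make up the full product.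
harris-kleitman : (U D : Family n) → IsUpper U → IsLower D →
                  2 ^ n * size (λ A → U A ∧ D A) ≤ size U * size D
harris-kleitman {zero} U D _ _ with U [] | D []
... | false | _     = z≤n
... | true  | false = z≤n
... | true  | true  = ≤-refl
harris-kleitman {suc n} U D up down
  rewrite size-suc (λ A → U A ∧ D A) | size-suc U | size-suc D = begin
  2 * N * (x₀ + x₁)                                    ≡⟨ distribute N x₀ x₁ ⟩
  2 * (N * x₀ + N * x₁)
    ≤⟨ *-monoʳ-≤ 2 (+-mono-≤ (harris-kleitman _ _ (up ∘ s⊆s) (down ∘ s⊆s))
                             (harris-kleitman _ _ (up ∘ s⊆s) (down ∘ s⊆s))) ⟩
  2 * (u₀ * d₀ + u₁ * d₁)                              ≡⟨ double (u₀ * d₀ + u₁ * d₁) ⟩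
  (u₀ * d₀ + u₁ * d₁) + (u₀ * d₀ + u₁ * d₁)
    ≤⟨ +-monoʳ-≤ (u₀ * d₀ + u₁ * d₁) (rearrangement u₀≤u₁ d₁≤d₀) ⟩
  (u₀ * d₀ + u₁ * d₁) + (u₀ * d₁ + u₁ * d₀)            ≡⟨ collect u₀ u₁ d₀ d₁ ⟩
  (u₀ + u₁) * (d₀ + d₁)                                ∎
  where
  open ≤-Reasoning
  N = 2 ^ n
  x₀ = size (λ A → U (outside ∷ A) ∧ D (outside ∷ A))
  x₁ = size (λ A → U (inside ∷ A) ∧ D (inside ∷ A))
  u₀ = size (U ∘ (outside ∷_))
  u₁ = size (U ∘ (inside ∷_))
  d₀ = size (D ∘ (outside ∷_))
  d₁ = size (D ∘ (inside ∷_))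
  u₀≤u₁ : u₀ ≤ u₁
  u₀≤u₁ = size-mono (U ∘ (outside ∷_)) (U ∘ (inside ∷_)) λ _ → up (out⊆ ⊆-refl)
  d₁≤d₀ : d₁ ≤ d₀
  d₁≤d₀ = size-mono (D ∘ (inside ∷_)) (D ∘ (outside ∷_)) λ _ → down (out⊆ ⊆-refl)
  distribute : ∀ N x y → 2 * N * (x + y) ≡ 2 * (N * x + N * y)
  distribute = solve-∀
  double : ∀ x → 2 * x ≡ x + x
  double = solve-∀
  collect : ∀ a b c d → (a * c + b * d) + (a * d + b * c) ≡ (a + b) * (c + d)
  collect = solve-∀

module _ (f : Family n) where

  -- Kept as a decision so that the up-closure is again a `Bool`-valued family and has a `size`.
  above? : ∀ A → Dec (∃[ B ] B ∈ᶠ f × B ⊆ A)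
  above? A = anySubset? λ B → T? (f B) ×-dec B ⊆? A

  below? : ∀ A → Dec (∃[ B ] B ∈ᶠ f × A ⊆ B)
  below? A = anySubset? λ B → T? (f B) ×-dec A ⊆? B

  ↑_ ↓_ : Family n
  ↑_ A = does (above? A)
  ↓_ A = does (below? A)

  ↑-isUpper : IsUpper ↑_
  ↑-isUpper {A} {B} A⊆B A∈↑ with C , C∈f , C⊆A ← does⁻ (above? A) A∈↑ =
    does⁺ (above? B) (C , C∈f , ⊆-trans C⊆A A⊆B)

  ↓-isLower : IsLower ↓_
  ↓-isLower {A} {B} A⊆B B∈↓ with C , C∈f , B⊆C ← does⁻ (below? B) B∈↓ =
    does⁺ (below? A) (C , C∈f , ⊆-trans A⊆B B⊆C)

  size≤↑*↓ : 2 ^ n * size f ≤ size ↑_ * size ↓_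
  size≤↑*↓ = ≤-trans
    (*-monoʳ-≤ (2 ^ n) (size-mono f (λ A → (↑_) A ∧ (↓_) A) λ A A∈f →
      Equivalence.from T-∧ (does⁺ (above? A) (A , A∈f , ⊆-refl) ,
                            does⁺ (below? A) (A , A∈f , ⊆-refl))))
    (harris-kleitman ↑_ ↓_ ↑-isUpper ↓-isLower)

-- Cross-IU pairs of families.

∩-disjoint : ∀ {A B C : Subset n} → B ⊆ A → C ⊆ ∁ A → B ∩ C ≡ ⊥
∩-disjoint {B = B} {C} B⊆A C⊆∁A = ⊆-antisym
  (λ x∈B∩C → let x∈B , x∈C = x∈p∩q⁻ B C x∈B∩C in
    ⊥-elim (x∈p⇒x∉∁p (B⊆A x∈B) (C⊆∁A x∈C)))
  ⊥⊆

∪-covers : ∀ {A B C : Subset n} → A ⊆ B → ∁ A ⊆ C → B ∪ C ≡ ⊤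
∪-covers {A = A} {B} {C} A⊆B ∁A⊆C = ⊆-antisym ⊆⊤ λ {x} _ → covers x
  where
  covers : ∀ x → _
  covers x with x ∈? A
  ... | yes x∈A = x∈p∪q⁺ (inj₁ (A⊆B x∈A))
  ... | no  x∉A = x∈p∪q⁺ (inj₂ (∁A⊆C (x∉p⇒x∈∁p x∉A)))

-- The number `s` stands in for the minimum of the two sizes, so both Harris-Kleitman bounds share
-- the left side `2 ^ n * s`.
cross-IU-bound : (P Q : Family n) →
  (∀ A B → A ∈ᶠ P → B ∈ᶠ Q → A ∩ B ≢ ⊥ × A ∪ B ≢ ⊤) →
  ∀ {s} → s ≤ size P → s ≤ size Q → 4 * s ≤ 2 ^ n
cross-IU-bound {n} P Q cross s≤P s≤Q =
  quarter-bound {u = size (↑ P)} {d = size (↓ P)} (m^n>0 2 n)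
    (≤-trans (*-monoʳ-≤ (2 ^ n) s≤P) (size≤↑*↓ P))
    (≤-trans (*-monoʳ-≤ (2 ^ n) s≤Q) (size≤↑*↓ Q))
    -- A member of `P` inside `A` and a member of `Q` inside `∁ A` would be disjoint.
    (size-complement (↑ P) (↑ Q) λ A A∈↑P ∁A∈↑Q →
      let B , B∈P , B⊆A  = does⁻ (above? P A) A∈↑P
          C , C∈Q , C⊆∁A = does⁻ (above? Q (∁ A)) ∁A∈↑Q
      in proj₁ (cross B C B∈P C∈Q) (∩-disjoint B⊆A C⊆∁A))
    -- Dually, members containing `A` and `∁ A` would cover everything.
    (size-complement (↓ P) (↓ Q) λ A A∈↓P ∁A∈↓Q →
      let B , B∈P , A⊆B  = does⁻ (below? P A) A∈↓P
          C , C∈Q , ∁A⊆C = does⁻ (below? Q (∁ A)) ∁A∈↓Q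
      in proj₂ (cross B C B∈P C∈Q) (∪-covers A⊆B ∁A⊆C))

-- From sturdiness to the sections at the first two points.

sturdiness≤section : (2≤n : 2 ≤ n) (𝓖 : Family n) (i j : Fin n) → i ≢ j →
                     sturdiness 2≤n 𝓖 ≤ size (section 𝓖 i j)
sturdiness≤section (s≤s (s≤s z≤n)) 𝓖 i j i≢j =
  All.lookup (min≤xs _ _)
    (∈-map⁺ (uncurry λ i j → size (section 𝓖 i j))
      (∈-filter⁺ (uncurry λ i j → ¬? (i ≟ᶠ j))
        (∈-cartesianProduct⁺ (∈-allFin i) (∈-allFin j)) i≢j))

-- Sections remain families on all `2 + n` points although their members avoid the first two; of the
-- four quarters of the cube only one then contributes.
size-embedded : (f : Family (2 + n)) (g : Family n) →
  (∀ A → A ∈ᶠ f → ∃[ B ] A ≡ outside ∷ outside ∷ B × B ∈ᶠ g) → size f ≤ size g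
size-embedded f g f⊆g = begin
  size f                                  ≡⟨ size-outside f (λ _ → case₀ ∘ f⊆g _) ⟩
  size (f ∘ (outside ∷_))                 ≡⟨ size-outside (f ∘ (outside ∷_)) (λ _ → case₁ ∘ f⊆g _) ⟩
  size (λ A → f (outside ∷ outside ∷ A))  ≤⟨ size-mono (λ A → f (outside ∷ outside ∷ A)) g (λ _ → case₂ ∘ f⊆g _) ⟩
  size g                                  ∎
  where
  open ≤-Reasoning
  case₀ : ∀ {A} → ¬ (∃[ B ] inside ∷ A ≡ outside ∷ outside ∷ B × B ∈ᶠ g)
  case₀ (_ , () , _)
  case₁ : ∀ {A} → ¬ (∃[ B ] outside ∷ inside ∷ A ≡ outside ∷ outside ∷ B × B ∈ᶠ g)
  case₁ (_ , () , _)
  case₂ : ∀ {A} → ∃[ B ] outside ∷ outside ∷ A ≡ outside ∷ outside ∷ B × B ∈ᶠ g → A ∈ᶠ g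
  case₂ (_ , refl , A∈g) = A∈g

size-section₀₁ : (𝓖 : Family (2 + n)) →
  size (section 𝓖 zero (suc zero)) ≤ size (λ B → 𝓖 (inside ∷ outside ∷ B))
size-section₀₁ 𝓖 = size-embedded _ _ λ A A∈ →
  restrict (does⁻ (inSection? 𝓖 zero (suc zero) A) A∈)
  where
  restrict : ∀ {A} → InSection 𝓖 zero (suc zero) A →
             ∃[ B ] A ≡ outside ∷ outside ∷ B × inside ∷ outside ∷ B ∈ᶠ 𝓖
  -- Deleting the point 0 subtracts its singleton, whose tail is `⊥`; hence `p─⊥≡p` on the remaining
  -- coordinates.
  restrict (true ∷ false ∷ F , F∈𝓖 , _ , A≡) =
    F , trans A≡ (cong (λ B → outside ∷ outside ∷ B) (p─⊥≡p F)) , F∈𝓖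
  restrict (true  ∷ true ∷ F , _ , () , _)
  restrict (false ∷ _    ∷ F , _ , () , _)

size-section₁₀ : (𝓖 : Family (2 + n)) →
  size (section 𝓖 (suc zero) zero) ≤ size (λ B → 𝓖 (outside ∷ inside ∷ B))
size-section₁₀ 𝓖 = size-embedded _ _ λ A A∈ →
  restrict (does⁻ (inSection? 𝓖 (suc zero) zero A) A∈)
  where
  restrict : ∀ {A} → InSection 𝓖 (suc zero) zero A →
             ∃[ B ] A ≡ outside ∷ outside ∷ B × outside ∷ inside ∷ B ∈ᶠ 𝓖
  restrict (false ∷ true ∷ F , F∈𝓖 , _ , A≡) =
    F , trans A≡ (cong (λ B → outside ∷ outside ∷ B) (p─⊥≡p F)) , F∈𝓖
  restrict (true  ∷ _     ∷ F , _ , () , _)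
  restrict (false ∷ false ∷ F , _ , () , _)

theorem1p3 : (n : ℕ) (2≤n : 2 ≤ n) (𝓖 : Family n) → IsIU 𝓖 →
    2 ^ 4 * sturdiness 2≤n 𝓖 ≤ 2 ^ n
theorem1p3 (suc (suc k)) 2≤n@(s≤s (s≤s z≤n)) 𝓖 isIU = begin
  -- One factor 4 is absorbed by the cross-IU bound on `k` points, the other by the two removed
  -- points.
  16 * s        ≡⟨ *-assoc 4 4 s ⟩
  4 * (4 * s)   ≤⟨ *-monoʳ-≤ 4 (cross-IU-bound P Q cross s≤P s≤Q) ⟩
  4 * 2 ^ k     ≡⟨ *-assoc 2 2 (2 ^ k) ⟩
  2 ^ (2 + k)   ∎
  where
  open ≤-Reasoning
  s = sturdiness 2≤n 𝓖
  P Q : Family k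
  P A = 𝓖 (inside ∷ outside ∷ A)
  Q A = 𝓖 (outside ∷ inside ∷ A)
  s≤P : s ≤ size P
  s≤P = ≤-trans (sturdiness≤section 2≤n 𝓖 zero (suc zero) λ ()) (size-section₀₁ 𝓖)
  s≤Q : s ≤ size Q
  s≤Q = ≤-trans (sturdiness≤section 2≤n 𝓖 (suc zero) zero λ ()) (size-section₁₀ 𝓖)
  cross : ∀ A B → A ∈ᶠ P → B ∈ᶠ Q → A ∩ B ≢ ⊥ × A ∪ B ≢ ⊤
  -- On the first two points these sets are already disjoint and cover both, so the IU condition
  -- must be met on the tails.
  cross A B A∈ B∈ with A∩B≢⊥ , A∪B≢⊤ ← isIU (inside ∷ outside ∷ A) (outside ∷ inside ∷ B) A∈ B∈ =
    A∩B≢⊥ ∘ cong (λ C → outside ∷ outside ∷ C) , A∪B≢⊤ ∘ cong (λ C → inside ∷ inside ∷ C)
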